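{- Let $k\ge 1$ and $n\ge 0$ be integers. The $k+1$ statistics $\mathrm{pk}_0,\mathrm{pk}_1,\dots,\mathrm{pk}_{k-1},\mathrm{dd}$ are equidistributed on $\mathcal{P}^k_n$; that is, for every integer $r\ge 0$, the number of $P\in\mathcal{P}^k_n$ with $\mathrm{st}(P)=r$ is the same for every $\mathrm{st}\in\{\mathrm{pk}_0,\dots,\mathrm{pk}_{k-1},\mathrm{dd}\}$.
   Context: A $k$-Dyck path of down-size $n$ is a lattice path from $(0,0)$ to $((k+1)n,0)$ with steps $u=(1,1)$ and $d=(1,-k)$ that stays in the first quadrant (never goes below the $x$-axis). $\mathcal{P}^k_n$ is the set of all such paths. A peak is a block of two consecutive steps $ud$; its height is the second coordinate of the left endpoint of its $d$ step. A double descent is a block $dd$ of two consecutive steps. For $0\le i\le k-1$, $\mathrm{pk}_i(P)$ is the number of non-rightmost peaks of $P$ (all peaks except the last one) whose height is congruent to $i$ modulo $k$; $\mathrm{dd}(P)$ is the number of double descents of $P$. All statistics are $0$ on the empty path ($n=0$). -}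

module Defs where

open import Data.Empty using (⊥)
open import Data.Fin using (Fin; toℕ)
open import Data.Integer as ℤ using (ℤ; +_; -_; 0ℤ; 1ℤ)
open import Data.Integer.DivMod using (_%ℕ_)
open import Data.List using (List; []; _∷_; _++_; map; foldr; filter; length; take; inits)
open import Data.List.Membership.Propositional using (_∈_)
open import Data.List.Membership.Propositional.Properties
  using (∈-map⁺; ∈-map⁻; ∈-++⁺ˡ; ∈-++⁺ʳ; ∈-filter⁺; ∈-filter⁻)
open import Data.List.Properties using (∷-injectiveʳ)
open import Data.List.Relation.Unary.All using (All; all?; [])
open import Data.List.Relation.Unary.Any using (here)
open import Data.List.Relation.Unary.Unique.Propositional using (Unique; []; _∷_)
open import Data.List.Relation.Unary.Unique.Propositional.Properties
  using (map⁺; ++⁺; filter⁺)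
open import Data.Nat as ℕ using (ℕ; zero; suc; pred; NonZero)
open import Data.Product using (_×_; _,_; proj₂; ∃-syntax)
open import Function.Bundles using (_⇔_; mk⇔)
open import Relation.Binary.PropositionalEquality using (_≡_; refl; sym)
open import Relation.Nullary.Decidable using (_×-dec_)
open import Relation.Unary using (Decidable)

data Step : Set where
  u d : Step

Word : Set
Word = List Step

-- Both steps advance the abscissa by 1, so a path is determined by its word of
-- steps and the abscissa of a vertex is the number of steps before it.
rise : ℕ → Step → ℤ
rise k u = 1ℤ
rise k d = - (+ k)

height : ℕ → Word → ℤ
height k w = foldr ℤ._+_ 0ℤ (map (rise k) w)

-- Ends at ((k+1)n , 0), with every vertex (the end of some prefix) on or above
-- the x-axis.
IsDyckPath : ℕ → ℕ → Word → Set
IsDyckPath k n w =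
  length w ≡ suc k ℕ.* n ×
  height k w ≡ 0ℤ ×
  All (λ v → 0ℤ ℤ.≤ height k v) (inits w)

isDyckPath? : ∀ k n → Decidable (IsDyckPath k n)
isDyckPath? k n w =
  (length w ℕ.≟ suc k ℕ.* n) ×-dec
  (height k w ℤ.≟ 0ℤ) ×-dec
  all? (λ v → 0ℤ ℤ.≤? height k v) (inits w)

words : ℕ → List Word
words zero    = [] ∷ []
words (suc m) = map (u ∷_) (words m) ++ map (d ∷_) (words m)

paths : ℕ → ℕ → List Word
paths k n = filter (isDyckPath? k n) (words (suc k ℕ.* n))

-- The list `paths k n` contains each k-Dyck path of down-size n exactly once
-- (∈-paths and paths-unique), so counting in it counts paths.
∈-words : ∀ w → w ∈ words (length w)
∈-words []      = here refl
∈-words (u ∷ w) = ∈-++⁺ˡ (∈-map⁺ (u ∷_) (∈-words w))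
∈-words (d ∷ w) = ∈-++⁺ʳ (map (u ∷_) (words (length w))) (∈-map⁺ (d ∷_) (∈-words w))

words-unique : ∀ m → Unique (words m)
words-unique zero    = [] ∷ []
words-unique (suc m) =
  ++⁺ (map⁺ ∷-injectiveʳ (words-unique m)) (map⁺ ∷-injectiveʳ (words-unique m))
      λ (p , q) → disjoint (∈-map⁻ (u ∷_) p) (∈-map⁻ (d ∷_) q)
  where
  disjoint : ∀ {w} → ∃[ x ] (x ∈ words m × w ≡ u ∷ x) →
             ∃[ y ] (y ∈ words m × w ≡ d ∷ y) → ⊥
  disjoint (_ , _ , refl) (_ , _ , ())

∈-paths : ∀ k n w → w ∈ paths k n ⇔ IsDyckPath k n w
∈-paths k n w = mk⇔
  (λ p → proj₂ (∈-filter⁻ (isDyckPath? k n) {xs = words (suc k ℕ.* n)} p))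
  (λ p → ∈-filter⁺ (isDyckPath? k n) (complete p) p)
  where
  complete : IsDyckPath k n w → w ∈ words (suc k ℕ.* n)
  complete (len , _) rewrite sym len = ∈-words w

paths-unique : ∀ k n → Unique (paths k n)
paths-unique k n = filter⁺ (isDyckPath? k n) (words-unique (suc k ℕ.* n))

-- Heights of the peaks ud, from left to right, of a path starting at height h.
peakHeightsFrom : ℕ → ℤ → Word → List ℤ
peakHeightsFrom k h []              = []
peakHeightsFrom k h (u ∷ w@(d ∷ _)) = h ℤ.+ rise k u ∷ peakHeightsFrom k (h ℤ.+ rise k u) w
peakHeightsFrom k h (s ∷ w)         = peakHeightsFrom k (h ℤ.+ rise k s) w

peakHeights : ℕ → Word → List ℤ
peakHeights k = peakHeightsFrom k 0ℤ

dropLast : {A : Set} → List A → List A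
dropLast xs = take (pred (length xs)) xs

pk : (k : ℕ) .{{_ : NonZero k}} → Fin k → Word → ℕ
pk k i w = length (filter (λ h → h %ℕ k ℕ.≟ toℕ i) (dropLast (peakHeights k w)))

-- Occurrences may overlap: ddd contains two double descents.
dd : Word → ℕ
dd []              = 0
dd (d ∷ w@(d ∷ _)) = suc (dd w)
dd (_ ∷ w)         = dd w

data Statistic (k : ℕ) : Set where
  pkₛ : Fin k → Statistic k
  ddₛ : Statistic k

value : (k : ℕ) .{{_ : NonZero k}} → Statistic k → Word → ℕ
value k (pkₛ i) = pk k i
value k ddₛ     = dd

count : (k : ℕ) .{{_ : NonZero k}} → ℕ → Statistic k → ℕ → ℕ
count k n st r = length (filter (λ w → value k st w ℕ.≟ r) (paths k n))

{-# OPTIONS --safe #-}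
module Submission where

-- A d step of a k-Dyck path of down-size n that is not the final step is
-- followed either by d, and is then counted by dd, or by u, and then starts a
-- valley du.  Between a non-rightmost peak and the next valley there are only d
-- steps, which preserve heights modulo k, so pk i counts the valleys whose lowest
-- vertex has height congruent to i (pk≡valleys).
--
-- A nonempty k-Dyck path decomposes uniquely as
--
--   w₀ u w₁ u ... u wₖ d
--
-- with every wⱼ a k-Dyck path: drop the final d, which starts at height k, and cut
-- at the last visits to the heights 0, 1, ..., k - 1 of what remains
-- (join-surjective, join-injective).  The pairs of consecutive steps that start
-- with d lie inside some wⱼ, or consist of the last step of a nonempty wⱼ and the
-- step after wⱼ.  Raising wⱼ to height j shifts the residues
-- by j, so
--
--   dd P   = Σⱼ dd wⱼ         + [wₖ nonempty],
--   pk i P = Σⱼ pk (i - j) wⱼ + [wᵢ nonempty],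
--
-- where i - j is taken modulo k.  In all cases a statistic is the sum of
-- statistics of the k + 1 factors plus the indicator that one special factor is
-- nonempty (stat-join).
--
-- Hence each statistic s gives a bijection enc s from (k+1)-ary trees onto k-Dyck
-- paths: the first subtree of the root is encoded in the special factor, the
-- other subtrees in the remaining factors in order, each through the statistic
-- that its factor contributes (enc-injective, enc-surjective).  By construction
-- neither the length of enc s t nor the value of s at enc s t depends on s
-- (length-enc, value-enc).  Hence enc s′ ∘ (enc s)⁻¹ carries the paths with
-- s = r onto those with s′ = r.

open import Data.Empty using (⊥; ⊥-elim)
open import Data.Fin using (Fin; zero; suc; toℕ; fromℕ; inject₁; punchIn)
open import Data.Fin.Properties using (toℕ<n; toℕ-fromℕ; toℕ-inject₁; toℕ-injective)
open import Data.Integer as ℤ using (ℤ; +_; -_; 0ℤ; 1ℤ; +≤+)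
open import Data.Integer.DivMod using (_%ℕ_)
import Data.Integer.Properties as ℤₚ
open import Data.List using (List; []; _∷_; _++_; _∷ʳ_; map; filter; length; inits; initLast; _∷ʳ′_)
open import Data.List.Membership.Propositional using (_∈_)
open import Data.List.Membership.Propositional.Properties
  using (∈-map⁺; ∈-map⁻; ∈-filter⁺; ∈-filter⁻)
open import Data.List.Membership.Propositional.Properties.WithK using (unique∧set⇒bag)
open import Data.List.Properties
  using (∷-injective; ∷-injectiveʳ; ∷ʳ-injectiveˡ; filter-accept; filter-reject;
         ++-assoc; length-++; length-++-comm; length-map)
open import Data.List.Relation.Binary.BagAndSetEquality using (∼bag⇒↭)
open import Data.List.Relation.Binary.Permutation.Propositional.Properties using (↭-length)
import Data.List.Relation.Unary.All as ListAll
import Data.List.Relation.Unary.All.Properties as ListAllₚ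
open import Data.List.Relation.Unary.Any using (here; there)
open import Data.List.Relation.Unary.Unique.Propositional using (Unique)
import Data.List.Relation.Unary.Unique.Propositional.Properties as Uniqueₚ
open import Data.Nat using (ℕ; zero; suc; _+_; _*_; _≤_; _<_; _≟_; z≤n; s≤s; NonZero; _%_; _/_)
open import Data.Nat.DivMod
  using (m≡m%n+[m/n]*n; m%n%n≡m%n; [m+n]%n≡m%n; m<n⇒m%n≡m; n%n≡0; %-distribˡ-+)
open import Data.Nat.Properties
  using (+-assoc; +-comm; +-suc; +-identityʳ; *-identityʳ; *-zeroʳ; suc-injective; +-cancelˡ-≡; ≤-refl;
         ≤-trans; ≤-pred; m≤m+n; m≤n+m; n≤1+n; m≤n⇒∃[o]m+o≡n; +-commutativeSemigroup)
open import Algebra.Properties.CommutativeSemigroup +-commutativeSemigroup using (x∙yz≈y∙xz)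
open import Data.Product using (_×_; _,_; proj₁; proj₂; ∃-syntax)
open import Data.Sum using (_⊎_; inj₁; inj₂)
open import Data.Vec using (Vec; []; _∷_; lookup; insertAt; removeAt)
open import Data.Vec.Properties
  using (insertAt-lookup; removeAt-insertAt; insertAt-removeAt)
import Data.Vec.Properties as Vecₚ
open import Data.Vec.Relation.Unary.All using (All; []; _∷_)
import Data.Vec.Relation.Unary.All as VecAll
import Data.Vec.Relation.Unary.All.Properties as VecAllₚ
open import Function using (_∘_; mk⇔; Equivalence)
open import Relation.Binary.PropositionalEquality
open import Relation.Nullary using (Dec; yes; no)

open import Defs

-- Vectors and lists

insertAt⁺ : ∀ {A : Set} {P : A → Set} {m} {xs : Vec A m} j {x} →
  P x → All P xs → All P (insertAt xs j x)
insertAt⁺ zero    px pxs        = px ∷ pxs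
insertAt⁺ (suc j) px (py ∷ pxs) = py ∷ insertAt⁺ j px pxs

removeAt⁺ : ∀ {A : Set} {P : A → Set} {m} {xs : Vec A (suc m)} j →
  All P xs → All P (removeAt xs j)
removeAt⁺ zero    (px ∷ pxs)           = pxs
removeAt⁺ (suc j) (px ∷ pxs@(_ ∷ _))   = px ∷ removeAt⁺ j pxs

insertAt-injective : ∀ {A : Set} {m} {xs ys : Vec A m} j {x y} →
  insertAt xs j x ≡ insertAt ys j y → x ≡ y × xs ≡ ys
insertAt-injective {xs = xs} {ys} j {x} {y} e =
  trans (sym (insertAt-lookup xs j x))
    (trans (cong (λ v → lookup v j) e) (insertAt-lookup ys j y)) ,
  trans (sym (removeAt-insertAt xs j x))
    (trans (cong (λ v → removeAt v j) e) (removeAt-insertAt ys j y))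

preimages : ∀ {A B : Set} {f : A → B} {ys} →
  (∀ {y} → y ∈ ys → ∃[ x ] f x ≡ y) → ∃[ xs ] map f xs ≡ ys
preimages {ys = []}     h = [] , refl
preimages {ys = y ∷ ys} h with h (here refl) | preimages {ys = ys} (h ∘ there)
... | x , refl | xs , refl = x ∷ xs , refl

module DyckPaths (p : ℕ) where

  -- Working with k = suc p makes Fin k inhabited by definition.
  k : ℕ
  k = suc p

  -- Lattice walks as words

  -- Walk a b w: the word w, read from height a, ends at height b and stays at
  -- nonnegative heights.  Heights are natural numbers, so down is possible only
  -- from a height of the form k + a′.
  data Walk : ℕ → ℕ → Word → Set where
    stop : ∀ {a} → Walk a a []
    up   : ∀ {a b w} → Walk (suc a) b w → Walk a b (u ∷ w)
    down : ∀ {a a′ b w} → a ≡ k + a′ → Walk a′ b w → Walk a b (d ∷ w)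

  raise : ∀ {a b w} → Walk a b w → Walk (suc a) (suc b) w
  raise stop                = stop
  raise (up W)              = up (raise W)
  raise (down {a′ = a′} e W) = down (trans (cong suc e) (sym (+-suc k a′))) (raise W)

  _++ʷ_ : ∀ {a b c v w} → Walk a b v → Walk b c w → Walk a c (v ++ w)
  stop     ++ʷ W = W
  up V     ++ʷ W = up (V ++ʷ W)
  down e V ++ʷ W = down e (V ++ʷ W)

  unsnoc-down : ∀ {a b} v → Walk a b (v ∷ʳ d) → Walk a (k + b) v
  unsnoc-down []      (down refl stop) = stop
  unsnoc-down (_ ∷ v) (up W)           = up (unsnoc-down v W)
  unsnoc-down (_ ∷ v) (down e W)       = down e (unsnoc-down v W)

  last-not-up : ∀ {a} v → Walk a 0 (v ∷ʳ u) → ⊥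
  last-not-up []      (up ())
  last-not-up (_ ∷ v) (up W)     = last-not-up v W
  last-not-up (_ ∷ v) (down _ W) = last-not-up v W

  rise-up : ∀ a → + a ℤ.+ 1ℤ ≡ + suc a
  rise-up a = cong +_ (+-comm a 1)

  rise-down : ∀ a → + (k + a) ℤ.+ - (+ k) ≡ + a
  rise-down a = begin
    (+ k ℤ.+ + a) ℤ.+ - (+ k)  ≡⟨ cong (ℤ._+ - (+ k)) (ℤₚ.+-comm (+ k) (+ a)) ⟩
    (+ a ℤ.+ + k) ℤ.+ - (+ k)  ≡⟨ ℤₚ.+-assoc (+ a) (+ k) (- (+ k)) ⟩
    + a ℤ.+ (+ k ℤ.+ - (+ k))  ≡⟨ cong (ℤ._+_ (+ a)) (ℤₚ.+-inverseʳ (+ k)) ⟩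
    + a ℤ.+ 0ℤ                 ≡⟨ ℤₚ.+-identityʳ (+ a) ⟩
    + a                        ∎
    where open ≡-Reasoning

  height-∷ : ∀ x {y} s w → x ℤ.+ rise k s ≡ y → x ℤ.+ height k (s ∷ w) ≡ y ℤ.+ height k w
  height-∷ x s w refl = sym (ℤₚ.+-assoc x (rise k s) (height k w))

  -- Every vertex of w, read from height x, is on or above the x-axis.
  Nonneg : ℤ → Word → Set
  Nonneg x w = ListAll.All (λ v → 0ℤ ℤ.≤ x ℤ.+ height k v) (inits w)

  nonneg-∷⁺ : ∀ {a y} s w → + a ℤ.+ rise k s ≡ y → Nonneg y w → Nonneg (+ a) (s ∷ w)
  nonneg-∷⁺ {a} s w e N =
    +≤+ z≤n ListAll.∷
    ListAllₚ.map⁺ (ListAll.map (λ {v} → subst (0ℤ ℤ.≤_) (sym (height-∷ (+ a) s v e))) N)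

  nonneg-∷⁻ : ∀ x {y} s w → x ℤ.+ rise k s ≡ y → Nonneg x (s ∷ w) → Nonneg y w
  nonneg-∷⁻ x s w e (_ ListAll.∷ N) =
    ListAll.map (λ {v} → subst (0ℤ ℤ.≤_) (height-∷ x s v e)) (ListAllₚ.map⁻ N)

  walk-height : ∀ {a b w} → Walk a b w → + a ℤ.+ height k w ≡ + b
  walk-height {a} stop = ℤₚ.+-identityʳ (+ a)
  walk-height {a} {w = _ ∷ w} (up W) = trans (height-∷ (+ a) u w (rise-up a)) (walk-height W)
  walk-height {w = _ ∷ w} (down {a′ = a′} refl W) =
    trans (height-∷ (+ (k + a′)) d w (rise-down a′)) (walk-height W)

  walk-nonneg : ∀ {a b w} → Walk a b w → Nonneg (+ a) w
  walk-nonneg stop = +≤+ z≤n ListAll.∷ ListAll.[]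
  walk-nonneg {a} {w = _ ∷ w} (up W) = nonneg-∷⁺ {a} u w (rise-up a) (walk-nonneg W)
  walk-nonneg {w = _ ∷ w} (down {a′ = a′} refl W) = nonneg-∷⁺ {k + a′} d w (rise-down a′) (walk-nonneg W)

  nonneg-d : ∀ {a w} → Nonneg (+ a) (d ∷ w) → k ≤ a
  nonneg-d {a} (_ ListAll.∷ h ListAll.∷ _) = ℤₚ.drop‿+≤+ (ℤₚ.0≤i-j⇒j≤i
    (subst (λ z → 0ℤ ℤ.≤ + a ℤ.+ z) (ℤₚ.+-identityʳ (- (+ k))) h))

  nonneg-walk : ∀ {a b} w → + a ℤ.+ height k w ≡ + b → Nonneg (+ a) w → Walk a b w
  nonneg-walk {a} [] e N with refl ← ℤₚ.+-injective (trans (sym (ℤₚ.+-identityʳ (+ a))) e) = stop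
  nonneg-walk {a} (u ∷ w) e N =
    up (nonneg-walk w (trans (sym (height-∷ (+ a) u w (rise-up a))) e) (nonneg-∷⁻ (+ a) u w (rise-up a) N))
  nonneg-walk {a} (d ∷ w) e N with a′ , refl ← m≤n⇒∃[o]m+o≡n (nonneg-d {w = w} N) =
    down refl (nonneg-walk w (trans (sym (height-∷ (+ (k + a′)) d w (rise-down a′))) e)
                             (nonneg-∷⁻ (+ (k + a′)) d w (rise-down a′) N))

  dyck⇒walk : ∀ {n w} → IsDyckPath k n w → Walk 0 0 w
  dyck⇒walk {w = w} (_ , h , N) = nonneg-walk w (trans (ℤₚ.+-identityˡ _) h)
    (ListAll.map (λ {v} → subst (0ℤ ℤ.≤_) (sym (ℤₚ.+-identityˡ (height k v)))) N)

  walk⇒dyck : ∀ {n w} → length w ≡ suc k * n → Walk 0 0 w → IsDyckPath k n w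
  walk⇒dyck len W = len , trans (sym (ℤₚ.+-identityˡ _)) (walk-height W) ,
    ListAll.map (λ {v} → subst (0ℤ ℤ.≤_) (ℤₚ.+-identityˡ (height k v))) (walk-nonneg W)

  -- Decomposition of walks at last visits

  -- w₀ u w₁ u ... u wₘ
  join : ∀ {m} → Vec Word (suc m) → Word
  join (w ∷ [])           = w
  join (w ∷ ws@(_ ∷ _))   = w ++ u ∷ join ws

  join-walk : ∀ {m} {ws : Vec Word (suc m)} → All (Walk 0 0) ws → Walk 0 m (join ws)
  join-walk (W ∷ [])            = W
  join-walk (W ∷ Ws@(_ ∷ _))    = W ++ʷ up (raise (join-walk Ws))

  -- A walk that ends at a positive height either stays positive, and can be lowered
  -- by one, or splits at its last visit to height 0, which an up step follows.
  split-last-zero : ∀ {a b w} → Walk a (suc b) w →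
    (∃[ a′ ] a ≡ suc a′ × Walk a′ b w) ⊎
    (∃[ x ] ∃[ y ] w ≡ x ++ u ∷ y × Walk a 0 x × Walk 0 b y)
  split-last-zero stop = inj₁ (_ , refl , stop)
  split-last-zero {zero} {w = _ ∷ w} (up W) with split-last-zero W
  ... | inj₁ (_ , refl , W′)         = inj₂ ([] , w , refl , stop , W′)
  ... | inj₂ (x , y , refl , X , Y)  = inj₂ (u ∷ x , y , refl , up X , Y)
  split-last-zero {suc a} (up W) with split-last-zero W
  ... | inj₁ (_ , refl , W′)         = inj₁ (a , refl , up W′)
  ... | inj₂ (x , y , refl , X , Y)  = inj₂ (u ∷ x , y , refl , up X , Y)
  split-last-zero (down e W) with split-last-zero W
  ... | inj₁ (a′ , refl , W′)        = inj₁ (_ , trans e (+-suc k a′) , down refl W′)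
  ... | inj₂ (x , y , refl , X , Y)  = inj₂ (d ∷ x , y , refl , down e X , Y)

  join-surjective : ∀ {m w} → Walk 0 m w →
    ∃[ ws ] join {m} ws ≡ w × All (Walk 0 0) ws
  join-surjective {zero}  {w} W = w ∷ [] , refl , W ∷ []
  join-surjective {suc m} W with split-last-zero W
  ... | inj₂ (x , y , refl , X , Y) with join-surjective Y
  ...   | ws@(_ ∷ _) , refl , Ws = x ∷ ws , refl , X ∷ Ws

  -- The walk x, started one unit lower, would end at height -1.
  lower-walk-absurd : ∀ {a b x z} → Walk (suc a) 0 x → Walk a b (x ++ z) → ⊥
  lower-walk-absurd (up X) (up W) = lower-walk-absurd X W
  lower-walk-absurd (down e X) (down {a′ = a′} refl W)
    with refl ← +-cancelˡ-≡ k _ _ (trans (sym e) (sym (+-suc k a′))) = lower-walk-absurd X W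

  first-factor-unique : ∀ {a b b′ x x′ y y′} → Walk a 0 x → Walk a 0 x′ →
    Walk 0 b y → Walk 0 b′ y′ → x ++ u ∷ y ≡ x′ ++ u ∷ y′ → x ≡ x′ × y ≡ y′
  first-factor-unique stop stop Y Y′ e = refl , ∷-injectiveʳ e
  first-factor-unique stop (up X′) Y Y′ refl = ⊥-elim (lower-walk-absurd X′ Y)
  first-factor-unique (up X) stop Y Y′ refl = ⊥-elim (lower-walk-absurd X Y′)
  first-factor-unique (up X) (up X′) Y Y′ e
    with refl , e′ ← first-factor-unique X X′ Y Y′ (∷-injectiveʳ e) = refl , e′
  first-factor-unique (down refl X) (down f X′) Y Y′ e
    with refl ← +-cancelˡ-≡ k _ _ f
    with refl , e′ ← first-factor-unique X X′ Y Y′ (∷-injectiveʳ e) = refl , e′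

  join-injective : ∀ {m} {ws ws′ : Vec Word (suc m)} →
    All (Walk 0 0) ws → All (Walk 0 0) ws′ → join ws ≡ join ws′ → ws ≡ ws′
  join-injective (_ ∷ []) (_ ∷ []) refl = refl
  join-injective (W ∷ Ws@(_ ∷ _)) (W′ ∷ Ws′@(_ ∷ _)) e
    with refl , e′ ← first-factor-unique W W′ (join-walk Ws) (join-walk Ws′) e
    = cong₂ _∷_ refl (join-injective Ws Ws′ e′)

  length-factors : ∀ {m} (ws : Vec Word (suc m)) → All (λ w → length w ≤ length (join ws)) ws
  length-factors (w ∷ []) = ≤-refl ∷ []
  length-factors (w ∷ ws@(_ ∷ _)) rewrite length-++ w {u ∷ join ws} =
    m≤m+n _ _ ∷ VecAll.map (λ {v} h → ≤-trans h (≤-trans (n≤1+n _) (m≤n+m _ (length w)))) (length-factors ws)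

  -- Residues modulo k

  -- Subtraction of 1 modulo k.
  prev : Fin k → Fin k
  prev zero    = fromℕ p
  prev (suc i) = inject₁ i

  -- Subtraction of n modulo k.  A vertex of residue i has residue back n i relative
  -- to a starting point of height n.
  back : ℕ → Fin k → Fin k
  back zero    i = i
  back (suc n) i = back n (prev i)

  back-suc : ∀ n i → back (suc n) i ≡ prev (back n i)
  back-suc zero    i = refl
  back-suc (suc n) i = back-suc n (prev i)

  back-+ : ∀ m n i → back (m + n) i ≡ back n (back m i)
  back-+ zero    n i = refl
  back-+ (suc m) n i = back-+ m n (prev i)

  suc-prev : ∀ i → suc (toℕ (prev i)) % k ≡ toℕ i
  suc-prev zero    rewrite toℕ-fromℕ p = n%n≡0 k
  suc-prev (suc i) rewrite toℕ-inject₁ i = m<n⇒m%n≡m (toℕ<n (suc i))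

  suc-% : ∀ m → suc (m % k) % k ≡ suc m % k
  suc-% m = begin
    (1 + m % k) % k              ≡⟨ %-distribˡ-+ 1 (m % k) k ⟩
    (1 % k + m % k % k) % k      ≡⟨ cong (λ z → (1 % k + z) % k) (m%n%n≡m%n m k) ⟩
    (1 % k + m % k) % k          ≡⟨ %-distribˡ-+ 1 m k ⟨
    (1 + m) % k                  ∎
    where open ≡-Reasoning

  toℕ-back : ∀ n i → (n + toℕ (back n i)) % k ≡ toℕ i
  toℕ-back zero    i = m<n⇒m%n≡m (toℕ<n i)
  toℕ-back (suc n) i = begin
    suc (n + toℕ (back n (prev i))) % k        ≡⟨ suc-% (n + toℕ (back n (prev i))) ⟨
    suc ((n + toℕ (back n (prev i))) % k) % k  ≡⟨ cong (λ z → suc z % k) (toℕ-back n (prev i)) ⟩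
    suc (toℕ (prev i)) % k                     ≡⟨ suc-prev i ⟩
    toℕ i                                      ∎
    where open ≡-Reasoning

  back-period : ∀ i → back k i ≡ i
  back-period i = toℕ-injective (begin
    toℕ (back k i)            ≡⟨ m<n⇒m%n≡m (toℕ<n (back k i)) ⟨
    toℕ (back k i) % k        ≡⟨ [m+n]%n≡m%n (toℕ (back k i)) k ⟨
    (toℕ (back k i) + k) % k  ≡⟨ cong (_% k) (+-comm (toℕ (back k i)) k) ⟩
    (k + toℕ (back k i)) % k  ≡⟨ toℕ-back k i ⟩
    toℕ i                     ∎)
    where open ≡-Reasoning

  back-k+ : ∀ n i → back (k + n) i ≡ back n i
  back-k+ n i = trans (back-+ k n i) (cong (back n) (back-period i))

  back-% : ∀ n i → back n i ≡ back (n % k) i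
  back-% n i = begin
    back n i                          ≡⟨ cong (λ z → back z i) (m≡m%n+[m/n]*n n k) ⟩
    back (n % k + n / k * k) i        ≡⟨ back-+ (n % k) (n / k * k) i ⟩
    back (n / k * k) (back (n % k) i) ≡⟨ back-multiple (n / k) (back (n % k) i) ⟩
    back (n % k) i                    ∎
    where
    open ≡-Reasoning
    back-multiple : ∀ q j → back (q * k) j ≡ j
    back-multiple zero    j = refl
    back-multiple (suc q) j = trans (back-k+ (q * k) j) (back-multiple q j)

  back-toℕ : ∀ n i → n ≡ toℕ i → back n i ≡ zero
  back-toℕ zero    zero    e    = refl
  back-toℕ (suc n) (suc i) refl = back-toℕ n (inject₁ i) (sym (toℕ-inject₁ i))

  -- The indicator of the residue 0.
  hit : Fin k → ℕ
  hit zero    = 1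
  hit (suc _) = 0

  hit-back-yes : ∀ n i → n % k ≡ toℕ i → hit (back n i) ≡ 1
  hit-back-yes n i e = cong hit (trans (back-% n i) (back-toℕ (n % k) i e))

  hit-back-no : ∀ n i → n % k ≢ toℕ i → hit (back n i) ≡ 0
  hit-back-no n i ne with back n i | toℕ-back n i
  ... | suc _ | _ = refl
  ... | zero  | e rewrite +-identityʳ n = ⊥-elim (ne e)

  -- Peaks and valleys

  -- The number of valleys du of w whose lowest vertex is at a height congruent to
  -- i modulo k, relative to the start of w: since d preserves residues, each u
  -- lowers the residue still to be reached by one.
  valleys : Fin k → Word → ℕ
  valleys i []              = 0
  valleys i (u ∷ w)         = valleys (prev i) w
  valleys i (d ∷ w@(u ∷ _)) = hit i + valleys i w
  valleys i (d ∷ w)         = valleys i w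

  module _ (i : Fin k) where

    hit? : (h : ℤ) → Dec (h %ℕ k ≡ toℕ i)
    hit? h = h %ℕ k ≟ toℕ i

    -- The number of listed heights that are congruent to i modulo k.
    hits : List ℤ → ℕ
    hits = length ∘ filter hit?

    hits-∷ : ∀ h n hs → h %ℕ k ≡ n % k → hits (h ∷ hs) ≡ hit (back n i) + hits hs
    hits-∷ h n hs e with hit? h
    ... | yes q = trans (cong length (filter-accept hit? {h} {hs} q))
                        (cong (_+ hits hs) (sym (hit-back-yes n i (trans (sym e) q))))
    ... | no ¬q = trans (cong length (filter-reject hit? {h} {hs} ¬q))
                        (cong (_+ hits hs) (sym (hit-back-no n i (¬q ∘ trans e))))

    peaks-nonempty : ∀ {a} h w → Walk a 0 (u ∷ w) →
      ∃[ h′ ] ∃[ hs ] peakHeightsFrom k h (u ∷ w) ≡ h′ ∷ hs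
    peaks-nonempty h []      (up ())
    peaks-nonempty h (d ∷ w) _      = _ , _ , refl
    peaks-nonempty h (u ∷ w) (up W) = peaks-nonempty (h ℤ.+ 1ℤ) w W

    -- Each non-rightmost peak has the residue of the next valley.  In peaks-down, h is
    -- the height of the peak whose descent is being read: dropLast discards it
    -- exactly when that descent ends the word.
    peaks-up : ∀ {a} w → Walk a 0 (u ∷ w) →
      hits (dropLast (peakHeightsFrom k (+ a) (u ∷ w))) ≡ valleys (back a i) (u ∷ w)
    peaks-down : ∀ {a} h w → Walk a 0 (d ∷ w) → h %ℕ k ≡ a % k →
      hits (dropLast (h ∷ peakHeightsFrom k (+ a) (d ∷ w))) ≡ valleys (back a i) (d ∷ w)

    peaks-up []      (up ())
    peaks-up {a} (u ∷ w) (up W)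
      rewrite +-comm a 1 | sym (back-suc a i) = peaks-up w W
    peaks-up {a} (d ∷ w) (up W)
      rewrite +-comm a 1 | sym (back-suc a i) = peaks-down (+ suc a) w W refl

    peaks-down h []      (down refl W) _ = refl
    peaks-down h (d ∷ w) (down {a′ = a} refl W) e =
      trans (cong (λ z → hits (dropLast (h ∷ peakHeightsFrom k z (d ∷ w)))) (rise-down a))
        (trans (peaks-down h w W (trans e (trans (cong (_% k) (+-comm k a)) ([m+n]%n≡m%n a k))))
               (cong (λ j → valleys j (d ∷ w)) (sym (back-k+ a i))))
    peaks-down h (u ∷ w) (down {a′ = a} refl W) e =
      trans (cong (λ z → hits (dropLast (h ∷ peakHeightsFrom k z (u ∷ w)))) (rise-down a))
        (trans split (cong (_+_ (hit (back (k + a) i)))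
          (trans (peaks-up w W) (cong (λ j → valleys j (u ∷ w)) (sym (back-k+ a i))))))
      where
      split : hits (dropLast (h ∷ peakHeightsFrom k (+ a) (u ∷ w))) ≡
        hit (back (k + a) i) + hits (dropLast (peakHeightsFrom k (+ a) (u ∷ w)))
      split with _ , _ , eq ← peaks-nonempty (+ a) w W rewrite eq = hits-∷ h (k + a) _ e

    pk≡valleys : ∀ {w} → Walk 0 0 w → pk k i w ≡ valleys i w
    pk≡valleys stop            = refl
    pk≡valleys W@(up {w = w} _) = peaks-up w W

  -- Statistics of the decomposition

  -- The indicator of nonempty words.
  nonempty : Word → ℕ
  nonempty []      = 0
  nonempty (_ ∷ _) = 1

  nonempty-∷ʳ : ∀ w s → nonempty (w ∷ʳ s) ≡ 1
  nonempty-∷ʳ []      s = refl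
  nonempty-∷ʳ (_ ∷ _) s = refl

  -- Σⱼ f j wⱼ
  total : ∀ {m} → (Fin m → Word → ℕ) → Vec Word m → ℕ
  total f []       = 0
  total f (w ∷ ws) = f zero w + total (f ∘ suc) ws

  total-insertAt : ∀ {m} f (ws : Vec Word m) j w →
    total f (insertAt ws j w) ≡ f j w + total (f ∘ punchIn j) ws
  total-insertAt f ws       zero    w = refl
  total-insertAt f (v ∷ ws) (suc j) w =
    trans (cong (_+_ _) (total-insertAt (f ∘ suc) ws j w))
          (x∙yz≈y∙xz (f zero v) (f (suc j) w) (total (f ∘ suc ∘ punchIn j) ws))

  join-∷ʳ : ∀ {m} w (ws : Vec Word (suc m)) → join (w ∷ ws) ∷ʳ d ≡ w ++ u ∷ (join ws ∷ʳ d)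
  join-∷ʳ w ws@(_ ∷ _) = ++-assoc w (u ∷ join ws) (d ∷ [])

  length-join : ∀ {m} (ws : Vec Word (suc m)) →
    length (join ws ∷ʳ d) ≡ total (λ _ → length) ws + suc m
  length-join (w ∷ []) = trans (length-++ w) (cong (_+ 1) (sym (+-identityʳ _)))
  length-join {suc m} (w ∷ ws@(_ ∷ _)) = begin
    length (join (w ∷ ws) ∷ʳ d)                        ≡⟨ cong length (join-∷ʳ w ws) ⟩
    length (w ++ u ∷ (join ws ∷ʳ d))                   ≡⟨ length-++ w ⟩
    length w + suc (length (join ws ∷ʳ d))             ≡⟨ cong (λ z → length w + suc z) (length-join ws) ⟩
    length w + suc (total (λ _ → length) ws + suc m)   ≡⟨ cong (_+_ (length w)) (sym (+-suc _ (suc m))) ⟩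
    length w + (total (λ _ → length) ws + suc (suc m)) ≡⟨ +-assoc (length w) _ _ ⟨
    length w + total (λ _ → length) ws + suc (suc m)   ∎
    where open ≡-Reasoning

  dd-++-u : ∀ x y → dd (x ++ u ∷ y) ≡ dd x + dd y
  dd-++-u []          y = refl
  dd-++-u (u ∷ x)     y = dd-++-u x y
  dd-++-u (d ∷ [])    y = refl
  dd-++-u (d ∷ u ∷ x) y = dd-++-u x y
  dd-++-u (d ∷ d ∷ x) y = cong suc (dd-++-u (d ∷ x) y)

  -- A nonempty walk that ends at height 0 ends with d.
  dd-∷ʳ-d : ∀ {a w} → Walk a 0 w → dd (w ∷ʳ d) ≡ dd w + nonempty w
  dd-∷ʳ-d stop = refl
  dd-∷ʳ-d {w = u ∷ _ ∷ _} (up W) = dd-∷ʳ-d W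
  dd-∷ʳ-d {w = d ∷ []} (down e W) = refl
  dd-∷ʳ-d {w = d ∷ u ∷ x} (down e W) = dd-∷ʳ-d W
  dd-∷ʳ-d {w = d ∷ d ∷ x} (down e W) = cong suc (dd-∷ʳ-d W)

  dd-join : ∀ {m} {ws : Vec Word (suc m)} → All (Walk 0 0) ws →
    dd (join ws ∷ʳ d) ≡ total (λ _ → dd) ws + nonempty (lookup ws (fromℕ m))
  dd-join {ws = w ∷ []} (W ∷ []) =
    trans (dd-∷ʳ-d W) (cong (_+ nonempty w) (sym (+-identityʳ (dd w))))
  dd-join {suc m} {ws = w ∷ ws@(_ ∷ _)} (W ∷ Ws) = begin
    dd (join (w ∷ ws) ∷ʳ d)           ≡⟨ cong dd (join-∷ʳ w ws) ⟩
    dd (w ++ u ∷ (join ws ∷ʳ d))      ≡⟨ dd-++-u w _ ⟩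
    dd w + dd (join ws ∷ʳ d)          ≡⟨ cong (_+_ (dd w)) (dd-join Ws) ⟩
    dd w + (total (λ _ → dd) ws + nonempty (lookup ws (fromℕ m)))
                                      ≡⟨ +-assoc (dd w) _ _ ⟨
    dd w + total (λ _ → dd) ws + nonempty (lookup ws (fromℕ m)) ∎
    where open ≡-Reasoning

  valleys-∷ʳ-d : ∀ i w → valleys i (w ∷ʳ d) ≡ valleys i w
  valleys-∷ʳ-d i []          = refl
  valleys-∷ʳ-d i (u ∷ w)     = valleys-∷ʳ-d (prev i) w
  valleys-∷ʳ-d i (d ∷ [])    = refl
  valleys-∷ʳ-d i (d ∷ u ∷ w) = cong (_+_ (hit i)) (valleys-∷ʳ-d i (u ∷ w))
  valleys-∷ʳ-d i (d ∷ d ∷ w) = valleys-∷ʳ-d i (d ∷ w)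

  -- Read x from height a and let it end at height 0; the residue sought is i
  -- relative to height 0, hence back a i relative to the start of x.  The middle
  -- term accounts for the valley formed by the last step of x and the following u.
  valleys-++-u : ∀ {a x} i y → Walk a 0 x →
    valleys (back a i) (x ++ u ∷ y) ≡ valleys (back a i) x + (hit i * nonempty x + valleys (prev i) y)
  valleys-++-u i y stop rewrite *-zeroʳ (hit i) = refl
  valleys-++-u {a} {u ∷ _ ∷ _} i y (up W) rewrite sym (back-suc a i) = valleys-++-u i y W
  valleys-++-u {x = d ∷ []} i y (down refl stop)
    rewrite back-k+ 0 i | *-identityʳ (hit i) = refl
  valleys-++-u {x = d ∷ u ∷ x} i y (down {a′ = a} refl W) rewrite back-k+ a i =
    trans (cong (_+_ (hit (back a i))) (valleys-++-u i y W))
          (sym (+-assoc (hit (back a i)) _ _))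
  valleys-++-u {x = d ∷ d ∷ x} i y (down {a′ = a} refl W) rewrite back-k+ a i = valleys-++-u i y W

  -- The number of valleys of residue i in join ws that consist of the last step of
  -- a factor and the u after it.  The last factor has no such u.
  boundary : ∀ {m} → Fin k → Vec Word (suc m) → ℕ
  boundary i (w ∷ [])         = 0
  boundary i (w ∷ ws@(_ ∷ _)) = hit i * nonempty w + boundary (prev i) ws

  -- The first boundary of residue i is the one after factor i, which needs i < m.
  boundary-zero : ∀ {m} i (ws : Vec Word (suc m)) → m ≤ toℕ i → boundary i ws ≡ 0
  boundary-zero i       (w ∷ [])         _       = refl
  boundary-zero (suc i) (w ∷ ws@(_ ∷ _)) (s≤s h) =
    boundary-zero (inject₁ i) ws (subst (_ ≤_) (sym (toℕ-inject₁ i)) h)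

  -- With at most k boundaries, residue i occurs at a single one, the one after
  -- factor i.
  boundary-lookup : ∀ {m} i (ws : Vec Word (suc m)) j → toℕ j ≡ toℕ i → toℕ i < m → m ≤ k →
    boundary i ws ≡ nonempty (lookup ws j)
  boundary-lookup zero (w ∷ ws@(_ ∷ _)) zero e h (s≤s m≤p)
    rewrite boundary-zero (fromℕ p) ws (subst (_ ≤_) (sym (toℕ-fromℕ p)) m≤p) =
    trans (+-identityʳ _) (+-identityʳ _)
  boundary-lookup (suc i) (w ∷ ws@(_ ∷ _)) (suc j) e (s≤s h) m≤k =
    boundary-lookup (inject₁ i) ws j (trans (suc-injective e) (sym (toℕ-inject₁ i)))
      (subst (_< _) (sym (toℕ-inject₁ i)) h) (≤-trans (n≤1+n _) m≤k)

  valleys-join : ∀ {m} i {ws : Vec Word (suc m)} → All (Walk 0 0) ws →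
    valleys i (join ws ∷ʳ d) ≡ total (λ j → valleys (back (toℕ j) i)) ws + boundary i ws
  valleys-join i {w ∷ []} (W ∷ []) =
    trans (valleys-∷ʳ-d i w) (sym (trans (+-identityʳ _) (+-identityʳ _)))
  valleys-join i {w ∷ ws@(_ ∷ _)} (W ∷ Ws@(_ ∷ _)) = begin
    valleys i (join (w ∷ ws) ∷ʳ d)        ≡⟨ cong (valleys i) (join-∷ʳ w ws) ⟩
    valleys i (w ++ u ∷ (join ws ∷ʳ d))   ≡⟨ valleys-++-u i _ W ⟩
    valleys i w + (c + valleys (prev i) (join ws ∷ʳ d))
      ≡⟨ cong (λ z → valleys i w + (c + z)) (valleys-join (prev i) Ws) ⟩
    valleys i w + (c + (t + boundary (prev i) ws))
      ≡⟨ cong (_+_ (valleys i w)) (x∙yz≈y∙xz c t _) ⟩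
    valleys i w + (t + (c + boundary (prev i) ws))
      ≡⟨ +-assoc (valleys i w) t _ ⟨
    valleys i w + t + (c + boundary (prev i) ws) ∎
    where
    open ≡-Reasoning
    c t : ℕ
    c = hit i * nonempty w
    t = total (λ j → valleys (back (toℕ j) (prev i))) ws

  -- The position of the factor whose nonemptiness contributes to the statistic.
  special : Statistic k → Fin (suc k)
  special (pkₛ i) = inject₁ i
  special ddₛ     = fromℕ k

  -- The statistic to be evaluated on factor j.  Factor j starts at height j.
  factorStat : Statistic k → Fin (suc k) → Statistic k
  factorStat (pkₛ i) j = pkₛ (back (toℕ j) i)
  factorStat ddₛ     _ = ddₛ

  -- The values of the statistics in terms of pairs of consecutive steps; they agree
  -- with value on walks from height 0 to height 0.
  stat : Statistic k → Word → ℕ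
  stat (pkₛ i) = valleys i
  stat ddₛ     = dd

  value≡stat : ∀ s {w} → Walk 0 0 w → value k s w ≡ stat s w
  value≡stat (pkₛ i) W = pk≡valleys i W
  value≡stat ddₛ     W = refl

  stat-join : ∀ s {ws : Vec Word (suc k)} → All (Walk 0 0) ws →
    stat s (join ws ∷ʳ d) ≡ total (stat ∘ factorStat s) ws + nonempty (lookup ws (special s))
  stat-join (pkₛ i) {ws} Ws = trans (valleys-join i Ws)
    (cong (_+_ (total (λ j → valleys (back (toℕ j) i)) ws))
      (boundary-lookup i ws (inject₁ i) (toℕ-inject₁ i) (toℕ<n i) ≤-refl))
  stat-join ddₛ Ws = dd-join Ws

  -- Encoding trees as paths

  -- (k+1)-ary trees; the first subtree of a node is kept apart, since it is the one
  -- that is encoded in the special factor.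
  data Tree : Set where
    leaf : Tree
    node : Tree → Vec Tree k → Tree

  -- enc s is the bijection from trees to k-Dyck paths adapted to the statistic s;
  -- encAll f encodes tree j of a vector through f j, and factors lists the words
  -- w₀, ..., wₖ of the path that encodes a node.
  enc    : Statistic k → Tree → Word
  encAll : ∀ {m} → (Fin m → Statistic k) → Vec Tree m → Vec Word m
  factors : Statistic k → Tree → Vec Tree k → Vec Word (suc k)

  enc s leaf        = []
  enc s (node t ts) = join (factors s t ts) ∷ʳ d

  factors s t ts =
    insertAt (encAll (factorStat s ∘ punchIn (special s)) ts) (special s)
             (enc (factorStat s (special s)) t)

  encAll f []       = []
  encAll f (t ∷ ts) = enc (f zero) t ∷ encAll (f ∘ suc) ts

  enc-walk     : ∀ s t → Walk 0 0 (enc s t)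
  encAll-walk  : ∀ {m} f (ts : Vec Tree m) → All (Walk 0 0) (encAll f ts)
  factors-walk : ∀ s t ts → All (Walk 0 0) (factors s t ts)

  enc-walk s leaf        = stop
  enc-walk s (node t ts) =
    join-walk (factors-walk s t ts) ++ʷ down (sym (+-identityʳ k)) stop

  factors-walk s t ts =
    insertAt⁺ (special s) (enc-walk _ t) (encAll-walk _ ts)

  encAll-walk f []       = []
  encAll-walk f (t ∷ ts) = enc-walk (f zero) t ∷ encAll-walk (f ∘ suc) ts

  enc-injective    : ∀ s t t′ → enc s t ≡ enc s t′ → t ≡ t′
  encAll-injective : ∀ {m} f (ts ts′ : Vec Tree m) → encAll f ts ≡ encAll f ts′ → ts ≡ ts′

  enc-injective s leaf leaf e = refl
  enc-injective s leaf (node t ts) e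
    with () ← trans (cong nonempty e) (nonempty-∷ʳ (join (factors s t ts)) d)
  enc-injective s (node t ts) leaf e
    with () ← trans (cong nonempty (sym e)) (nonempty-∷ʳ (join (factors s t ts)) d)
  enc-injective s (node t ts) (node t′ ts′) e
    with e₁ , e₂ ← insertAt-injective (special s)
           (join-injective (factors-walk s t ts) (factors-walk s t′ ts′) (∷ʳ-injectiveˡ _ _ e))
    = cong₂ node (enc-injective _ t t′ e₁) (encAll-injective _ ts ts′ e₂)

  encAll-injective f []       []         e = refl
  encAll-injective f (t ∷ ts) (t′ ∷ ts′) e =
    cong₂ _∷_ (enc-injective (f zero) t t′ (proj₁ (Vecₚ.∷-injective e)))
              (encAll-injective (f ∘ suc) ts ts′ (proj₂ (Vecₚ.∷-injective e)))

  -- The hypothesis provides preimages under enc s for all s at once, because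
  -- different factors use different statistics.
  encAll-surjective : ∀ {m} f {ws : Vec Word m} →
    All (λ w → ∀ s → ∃[ t ] enc s t ≡ w) ws → ∃[ ts ] encAll f ts ≡ ws
  encAll-surjective f []       = [] , refl
  encAll-surjective f (h ∷ hs) with h (f zero) | encAll-surjective (f ∘ suc) hs
  ... | t , refl | ts , refl = t ∷ ts , refl

  factors-surjective : ∀ s {ws} → All (λ w → ∀ s → ∃[ t ] enc s t ≡ w) ws →
    ∃[ t ] ∃[ ts ] factors s t ts ≡ ws
  factors-surjective s {ws} hs
    with VecAllₚ.lookup⁺ hs (special s) (factorStat s (special s))
       | encAll-surjective (factorStat s ∘ punchIn (special s)) (removeAt⁺ (special s) hs)
  ... | t , e₁ | ts , e₂ = t , ts ,
    trans (cong₂ (λ vs v → insertAt vs (special s) v) e₂ e₁) (insertAt-removeAt ws (special s))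

  -- Induction on a bound n for the length, since the factors are shorter words but
  -- not structural parts of w.
  enc-surjective : ∀ n {w} → length w ≤ n → Walk 0 0 w → ∀ s → ∃[ t ] enc s t ≡ w
  enc-surjective n {w} len W s with initLast w
  enc-surjective n len W s | [] = leaf , refl
  enc-surjective n len W s | v ∷ʳ′ u = ⊥-elim (last-not-up v W)
  enc-surjective zero len W s | v ∷ʳ′ d with () ← subst (_≤ 0) (length-++-comm v (d ∷ [])) len
  enc-surjective (suc n) len W s | v ∷ʳ′ d
    with ws , refl , Ws ← join-surjective (subst (λ b → Walk 0 b v) (+-identityʳ k) (unsnoc-down v W))
    with t , ts , refl ← factors-surjective s
           (VecAll.map (λ (l , V) → enc-surjective n
                         (≤-trans l (≤-pred (subst (_≤ suc n) (length-++-comm v (d ∷ [])) len))) V)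
                       (VecAll.zip (length-factors ws , Ws)))
    = node t ts , refl

  -- A family f of functions on words, indexed by statistics, that decomposes along
  -- factorStat and special has a value at enc s t that depends on t only.  Applied
  -- to the lengths and to the statistics themselves.
  module _ (f : Statistic k → Word → ℕ) (e : Word → ℕ)
           (f-[] : ∀ s s′ → f s [] ≡ f s′ [])
           (f-join : ∀ s {ws} → All (Walk 0 0) ws →
              f s (join ws ∷ʳ d) ≡ total (f ∘ factorStat s) ws + e (lookup ws (special s)))
           (e-enc : ∀ s s′ t → e (enc s t) ≡ e (enc s′ t)) where

    enc-invariant : ∀ s s′ t → f s (enc s t) ≡ f s′ (enc s′ t)
    encAll-invariant : ∀ {m} g g′ (ts : Vec Tree m) →
      total (f ∘ g) (encAll g ts) ≡ total (f ∘ g′) (encAll g′ ts)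
    node-value : ∀ s t ts → f s (enc s (node t ts)) ≡
      f (factorStat s (special s)) (enc (factorStat s (special s)) t)
      + total (f ∘ factorStat s ∘ punchIn (special s)) (encAll (factorStat s ∘ punchIn (special s)) ts)
      + e (enc (factorStat s (special s)) t)

    node-value s t ts = trans (f-join s (factors-walk s t ts))
      (cong₂ _+_ (total-insertAt (f ∘ factorStat s) _ (special s) _)
                 (cong e (insertAt-lookup (encAll _ ts) (special s) _)))

    enc-invariant s s′ leaf = f-[] s s′
    enc-invariant s s′ (node t ts) =
      trans (node-value s t ts)
        (trans (cong₂ _+_ (cong₂ _+_ (enc-invariant _ _ t) (encAll-invariant _ _ ts)) (e-enc _ _ t))
               (sym (node-value s′ t ts)))

    encAll-invariant g g′ []       = refl
    encAll-invariant g g′ (t ∷ ts) =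
      cong₂ _+_ (enc-invariant (g zero) (g′ zero) t) (encAll-invariant (g ∘ suc) (g′ ∘ suc) ts)

  length-enc : ∀ s s′ t → length (enc s t) ≡ length (enc s′ t)
  length-enc = enc-invariant (λ _ → length) (λ _ → suc k)
    (λ _ _ → refl) (λ _ {ws} _ → length-join ws) (λ _ _ _ → refl)

  nonempty-enc : ∀ s s′ t → nonempty (enc s t) ≡ nonempty (enc s′ t)
  nonempty-enc s s′ leaf        = refl
  nonempty-enc s s′ (node t ts) =
    trans (nonempty-∷ʳ (join (factors s t ts)) d) (sym (nonempty-∷ʳ (join (factors s′ t ts)) d))

  stat-[] : ∀ s → stat s [] ≡ 0
  stat-[] (pkₛ i) = refl
  stat-[] ddₛ     = refl

  value-enc : ∀ s s′ t → value k s (enc s t) ≡ value k s′ (enc s′ t)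
  value-enc s s′ t = begin
    value k s (enc s t)    ≡⟨ value≡stat s (enc-walk s t) ⟩
    stat s (enc s t)       ≡⟨ enc-invariant stat nonempty
                                (λ s s′ → trans (stat-[] s) (sym (stat-[] s′)))
                                stat-join nonempty-enc s s′ t ⟩
    stat s′ (enc s′ t)     ≡⟨ value≡stat s′ (enc-walk s′ t) ⟨
    value k s′ (enc s′ t)  ∎
    where open ≡-Reasoning

  -- Counting

  -- The k-Dyck paths of down-size n with value r of the statistic s.
  level : ℕ → Statistic k → ℕ → List Word
  level n s r = filter (λ w → value k s w ≟ r) (paths k n)

  level-unique : ∀ n s r → Unique (level n s r)
  level-unique n s r = Uniqueₚ.filter⁺ (λ w → value k s w ≟ r) (paths-unique k n)

  ∈-level⁻ : ∀ n s r {w} → w ∈ level n s r → IsDyckPath k n w × value k s w ≡ r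
  ∈-level⁻ n s r {w} h with q , v ← ∈-filter⁻ (λ w → value k s w ≟ r) {xs = paths k n} h =
    Equivalence.to (∈-paths k n w) q , v

  ∈-level⁺ : ∀ n s r {w} → IsDyckPath k n w → value k s w ≡ r → w ∈ level n s r
  ∈-level⁺ n s r {w} D v =
    ∈-filter⁺ (λ w → value k s w ≟ r) (Equivalence.from (∈-paths k n w) D) v

  enc-level : ∀ n s s′ r {t} → enc s t ∈ level n s r → enc s′ t ∈ level n s′ r
  enc-level n s s′ r {t} h with (len , _) , v ← ∈-level⁻ n s r h =
    ∈-level⁺ n s′ r (walk⇒dyck {n} (trans (length-enc s′ s t) len) (enc-walk s′ t))
                    (trans (value-enc s′ s t) v)

  level-tree : ∀ n s r {w} → w ∈ level n s r → ∃[ t ] enc s t ≡ w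
  level-tree n s r {w} h =
    enc-surjective (length w) ≤-refl (dyck⇒walk {n} (proj₁ (∈-level⁻ n s r h))) s

  level-length : ∀ n s s′ r → length (level n s r) ≡ length (level n s′ r)
  level-length n s s′ r with ts , eq ← preimages (level-tree n s r) = begin
    length (level n s r)       ≡⟨ cong length eq ⟨
    length (map (enc s) ts)    ≡⟨ length-map (enc s) ts ⟩
    length ts                  ≡⟨ length-map (enc s′) ts ⟨
    length (map (enc s′) ts)   ≡⟨ ↭-length (∼bag⇒↭
                                    (unique∧set⇒bag unique (level-unique n s′ r) (mk⇔ to from))) ⟩
    length (level n s′ r)      ∎
    where
    open ≡-Reasoning
    unique : Unique (map (enc s′) ts)
    unique = Uniqueₚ.map⁺ (enc-injective s′ _ _)
      (Uniqueₚ.map⁻ (subst Unique (sym eq) (level-unique n s r)))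
    to : ∀ {w} → w ∈ map (enc s′) ts → w ∈ level n s′ r
    to h with t , t∈ts , refl ← ∈-map⁻ (enc s′) h =
      enc-level n s s′ r {t} (subst (enc s t ∈_) eq (∈-map⁺ (enc s) t∈ts))
    from : ∀ {w} → w ∈ level n s′ r → w ∈ map (enc s′) ts
    from h with t , refl ← level-tree n s′ r h
      with t′ , t′∈ts , e ← ∈-map⁻ (enc s) (subst (enc s t ∈_) (sym eq) (enc-level n s′ s r {t} h))
      with refl ← enc-injective s t t′ e = ∈-map⁺ (enc s′) t′∈ts

corollary2p9 : ∀ (k : ℕ) .{{_ : NonZero k}} (n : ℕ) (st st′ : Statistic k) (r : ℕ) →
    count k n st r ≡ count k n st′ r
corollary2p9 (suc p) n st st′ r = DyckPaths.level-length p n st st′ r
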